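{- Let $b\ge2$, $s\ge1$, and $u\ge0$ be integers and let $\boldsymbol{e}=(e_1,\ldots,e_s)\in\mathbb{N}^s$ be an $s$-tuple of positive integers. Then any $(u,\boldsymbol{e},s)$-sequence in base $b$ is a $(t,s)$-sequence in base $b$ with $$t=u+\sum_{i=1}^s(e_i-1).$$
   Context: Point sets are counted with multiplicity: for a point set $\mathcal{P}$ (finite indexed family), $A(J;\mathcal{P})$ is the number of indices $n$ with $\boldsymbol{x}_n\in J$. For integers $0\le u\le m$, a *$(u,m,\boldsymbol{e},s)$-net in base $b$* is a point set $\mathcal{P}$ of $b^m$ points in $[0,1)^s$ such that $A(J;\mathcal{P})=b^m\,\mathrm{Vol}(J)$ for every interval $J=\prod_{i=1}^s[a_ib^{ -d_i},(a_i+1)b^{ -d_i})$ with integers $d_i\ge0$, $0\le a_i<b^{d_i}$, $e_i\mid d_i$ for $1\le i\le s$, and $\mathrm{Vol}(J)\ge b^{u-m}$. For integers $0\le t\le m$, a *$(t,m,s)$-net in base $b$* is a point set of $b^m$ points in $[0,1)^s$ such that every interval $\prod_{i=1}^s[a_ib^{ -d_i},(a_i+1)b^{ -d_i})$ with integers $d_i\ge0$, $0\le a_i<b^{d_i}$ and volume $b^{t-m}$ contains exactly $b^t$ of the points. A sequence $\boldsymbol{x}_0,\boldsymbol{x}_1,\ldots$ of points in $[0,1]^s$ is a *$(u,\boldsymbol{e},s)$-sequence in base $b$* (resp. a *$(t,s)$-sequence in base $b$*) if for all integers $k\ge0$ and $m>u$ (resp. $m>t$) the points $[\boldsymbol{x}_n]_{b,m}$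 with $kb^m\le n<(k+1)b^m$ form a $(u,m,\boldsymbol{e},s)$-net (resp. a $(t,m,s)$-net) in base $b$. Here $[\boldsymbol{x}_n]_{b,m}$ is the coordinatewise $m$-digit truncation in base $b$, taken with respect to a fixed prescribed base-$b$ digit expansion $\sum_{j\ge1}x_jb^{ -j}$ of each coordinate (expansions with $x_j=b-1$ for all large $j$ are allowed). -}

module Defs where

open import Data.Fin.Base using (Fin; toℕ)
open import Data.Fin.Properties using (all?)
open import Data.Integer.Base using (+_)
open import Data.List.Base using (allFin; filter; length)
open import Data.Nat.Base as ℕ using (ℕ; suc; _^_; NonTrivial; nonTrivial⇒nonZero)
open import Data.Nat.Divisibility using (_∣_)
open import Data.Nat.Properties using (m^n≢0)
open import Data.Product.Base using (_×_)
open import Data.Rational.Base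
  using (ℚ; 0ℚ; 1ℚ; _/_; _*_; _-_; _≤_; _<_; _≥_; +-0-rawMonoid; *-1-rawMonoid)
open import Data.Rational.Properties using (_≤?_; _<?_)
open import Relation.Binary.PropositionalEquality.Core using (_≡_)
open import Relation.Nullary.Decidable.Core using (Dec; _×-dec_)

open import Algebra.Definitions.RawMonoid ℕ.+-0-rawMonoid public
  using () renaming (sum to ∑ℕ)
open import Algebra.Definitions.RawMonoid +-0-rawMonoid public
  using () renaming (sum to ∑)
open import Algebra.Definitions.RawMonoid *-1-rawMonoid public
  using () renaming (sum to ∏)

Point : ℕ → Set
Point s = Fin s → ℚ

-- Rational coordinates are enough for the nets below: they are formed from
-- m-digit truncations, which are always rational.
PointSet : ℕ → ℕ → Set
PointSet N s = Fin N → Point s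

InUnitCube : ∀ {s} → Point s → Set
InUnitCube x = ∀ i → 0ℚ ≤ x i × x i < 1ℚ

module _ (b : ℕ) .{{_ : NonTrivial b}} where

  infixl 7 _/b^_

  _/b^_ : ℕ → ℕ → ℚ
  a /b^ d = _/_ (+ a) (b ^ d) {{m^n≢0 b d {{nonTrivial⇒nonZero b}}}}

  record Interval (s : ℕ) : Set where
    field
      d : Fin s → ℕ
      a : (i : Fin s) → Fin (b ^ d i)

    lower upper : Fin s → ℚ
    lower i = toℕ (a i) /b^ d i
    upper i = suc (toℕ (a i)) /b^ d i

    Vol : ℚ
    Vol = ∏ λ i → upper i - lower i

    Contains : Point s → Set
    Contains x = ∀ i → lower i ≤ x i × x i < upper i

    contains? : ∀ x → Dec (Contains x)
    contains? x = all? λ i → (lower i ≤? x i) ×-dec (x i <? upper i)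

  open Interval using (d; Vol; contains?)

  A : ∀ {N s} → Interval s → PointSet N s → ℕ
  A {N} J P = length (filter (λ n → contains? J (P n)) (allFin N))

  -- In both kinds of net, b^{u-m} is written as b^u / b^m.  They are products
  -- rather than records because the positivity check of a record normalises the
  -- ℚ-valued equations in its fields, which exhausts memory.
  IsUMESNet : (u m : ℕ) {s : ℕ} → (Fin s → ℕ) → PointSet (b ^ m) s → Set
  IsUMESNet u m {s} e P =
    u ℕ.≤ m ×
    (∀ n → InUnitCube (P n)) ×
    (∀ (J : Interval s) → (∀ i → e i ∣ d J i) → Vol J ≥ (b ^ u) /b^ m →
       + A J P / 1 ≡ (+ (b ^ m) / 1) * Vol J)

  IsTMSNet : (t m : ℕ) {s : ℕ} → PointSet (b ^ m) s → Set
  IsTMSNet t m {s} P =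
    t ℕ.≤ m ×
    (∀ n → InUnitCube (P n)) ×
    (∀ (J : Interval s) → Vol J ≡ (b ^ t) /b^ m → A J P ≡ b ^ t)

  -- A point of [0,1] together with a prescribed base-b expansion
  -- ∑_{j≥1} x_j b^{-j}. Index j holds the digit x_{j+1}; there is no restriction
  -- on the tail, so expansions ending in b-1, b-1, … are included.
  Expansion : Set
  Expansion = ℕ → Fin b

  truncate : ℕ → Expansion → ℚ
  truncate m x = ∑ λ (j : Fin m) → toℕ (x (toℕ j)) /b^ suc (toℕ j)

  -- A sequence of points of [0,1]^s with prescribed expansions.
  PointSequence : ℕ → Set
  PointSequence s = ℕ → Fin s → Expansion

  -- The points [x_n]_{b,m} with k b^m ≤ n < (k+1) b^m.
  block : ∀ {s} → PointSequence s → (k m : ℕ) → PointSet (b ^ m) s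
  block x k m r i = truncate m (x (k ℕ.* b ^ m ℕ.+ toℕ r) i)

  IsUESSequence : (u : ℕ) {s : ℕ} → (Fin s → ℕ) → PointSequence s → Set
  IsUESSequence u e x = ∀ k m → m ℕ.> u → IsUMESNet u m e (block x k m)

  IsTSSequence : (t : ℕ) {s : ℕ} → PointSequence s → Set
  IsTSSequence t x = ∀ k m → m ℕ.> t → IsTMSNet t m (block x k m)

{-# OPTIONS --safe #-}
module Submission where

-- Call d equidistributed if every elementary interval of shape d holds its fair
-- share b^(m − Σd) of the points. Cutting an interval of shape d into b slabs
-- along coordinate i shows that equidistribution passes from d + 1ᵢ to d, hence
-- from any d + c down to d. Now if Σd = m − t, rounding each dᵢ up to a multiple
-- of eᵢ costs at most eᵢ − 1, so the refined shape has volume ≥ b^(u−m) and is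
-- covered by the hypothesis on u.

open import Data.Fin.Base using (Fin; zero; suc; toℕ; fromℕ<)
open import Data.Fin.Properties using (all?; toℕ<n; toℕ-fromℕ<)
import Data.Fin.Properties as Fin
open import Data.Integer.Base as ℤ using (ℤ; +_)
import Data.Integer.Properties as ℤ
import Data.Integer.Tactic.RingSolver as ℤ-Solver
open import Data.List.Base using ([]; _∷_; allFin; filter; length)
open import Data.List.Properties using (filter-≐; filter-none)
open import Data.List.Relation.Unary.All using (universal)
open import Data.Nat.Base
  using (ℕ; zero; suc; _+_; _*_; _∸_; _^_; _≤_; _<_; _≥_; z≤n; s≤s; NonZero; NonTrivial; nonTrivial⇒nonZero)
open import Data.Nat.Divisibility using (_∣_; ∣-refl; ∣m∣n⇒∣m+n; _∣0)
open import Data.Nat.Properties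
open import Data.Nat.Tactic.RingSolver using (solve-∀)
open import Data.Product.Base using (∃; _×_; _,_; proj₁; proj₂)
open import Data.Rational.Base as ℚ using (ℚ; _/_; toℚᵘ)
import Data.Rational.Properties as ℚ
open import Data.Rational.Unnormalised.Base as ℚᵘ using (mkℚᵘ; *≡*; *≤*)
import Data.Rational.Unnormalised.Properties as ℚᵘ
open import Data.Sum.Base using (_⊎_; inj₁; inj₂)
open import Data.Vec.Functional using (Vector; updateAt; tail) renaming (_∷_ to _∷ᵛ_)
open import Data.Vec.Functional.Properties
  using (updateAt-updates; updateAt-minimal; updateAt-updateAt; updateAt-id-local)
open import Function.Base using (const; _∘_)
open import Relation.Binary.PropositionalEquality hiding (J)
open import Relation.Nullary using (¬_; Dec; yes; no; contradiction)
open import Relation.Nullary.Decidable using (_×-dec_)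
open import Relation.Unary using (Decidable)

open import Algebra.Properties.CommutativeMonoid.Sum +-0-commutativeMonoid using (∑-distrib-+; sum-cong-≗)
open import Defs

-- Rounding up to a multiple

-- Induction on `d`: a positive padding for `d` shrinks by one for `suc d`. Padding zero means
-- `e ∣ d`, and then the next multiple `d + e` lies `e ∸ 1` above `suc d`.
∣-round-up : ∀ e d → e ≥ 1 → ∃ λ c → c ≤ e ∸ 1 × e ∣ d + c
∣-round-up e zero _ = 0 , z≤n , e ∣0
∣-round-up e (suc d) e≥1 with ∣-round-up e d e≥1
... | suc c , c<e , e∣d+c = c , <⇒≤ c<e , subst (e ∣_) (+-suc d c) e∣d+c
... | zero  , _   , e∣d   = e ∸ 1 , ≤-refl ,
  subst (e ∣_) (trans (cong (λ f → d + 0 + f) (sym (m+[n∸m]≡n e≥1))) (identity d (e ∸ 1)))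
    (∣m∣n⇒∣m+n e∣d ∣-refl)
  where
  identity : ∀ d f → d + 0 + (1 + f) ≡ suc d + f
  identity = solve-∀

-- Fractions of natural numbers

-- Division in `ℚ` cancels a gcd. The transfer to `ℚᵘ` avoids it: there equality and order are plain
-- cross-multiplication.
toℚᵘ-/ : ∀ p m .{{_ : NonZero m}} → toℚᵘ (+ p / m) ℚᵘ.≃ (+ p ℚᵘ./ m)
toℚᵘ-/ p (suc m) = ℚ.toℚᵘ-fromℚᵘ (mkℚᵘ (+ p) m)

module _ (p q m n : ℕ) .{{_ : NonZero m}} .{{_ : NonZero n}} where

  *≡*⇒/≡/ : p * n ≡ q * m → + p / m ≡ + q / n
  *≡*⇒/≡/ eq = ℚ.toℚᵘ-injective
    (ℚᵘ.≃-trans (toℚᵘ-/ p m) (ℚᵘ.≃-trans (go m n eq) (ℚᵘ.≃-sym (toℚᵘ-/ q n))))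
    where
    -- The denominators are quantified afresh so that they can be matched as successors, which lets
    -- the unnormalised fractions compute.
    go : ∀ m n .{{_ : NonZero m}} .{{_ : NonZero n}} → p * n ≡ q * m → (+ p ℚᵘ./ m) ℚᵘ.≃ (+ q ℚᵘ./ n)
    go (suc m) (suc n) eq = *≡* (begin
      + p ℤ.* + suc n ≡⟨ ℤ.pos-* p (suc n) ⟨
      + (p * suc n)   ≡⟨ cong +_ eq ⟩
      + (q * suc m)   ≡⟨ ℤ.pos-* q (suc m) ⟩
      + q ℤ.* + suc m ∎)
      where open ≡-Reasoning

  /≡/⇒*≡* : + p / m ≡ + q / n → p * n ≡ q * m
  /≡/⇒*≡* eq = go m n
    (ℚᵘ.≃-trans (ℚᵘ.≃-sym (toℚᵘ-/ p m)) (ℚᵘ.≃-trans (ℚᵘ.≃-reflexive (cong toℚᵘ eq)) (toℚᵘ-/ q n)))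
    where
    go : ∀ m n .{{_ : NonZero m}} .{{_ : NonZero n}} → (+ p ℚᵘ./ m) ℚᵘ.≃ (+ q ℚᵘ./ n) → p * n ≡ q * m
    go (suc m) (suc n) (*≡* eq) = ℤ.+-injective (begin
      + (p * suc n)   ≡⟨ ℤ.pos-* p (suc n) ⟩
      + p ℤ.* + suc n ≡⟨ eq ⟩
      + q ℤ.* + suc m ≡⟨ ℤ.pos-* q (suc m) ⟨
      + (q * suc m)   ∎)
      where open ≡-Reasoning

  *≤*⇒/≤/ : p * n ≤ q * m → + p / m ℚ.≤ + q / n
  *≤*⇒/≤/ le = ℚ.toℚᵘ-cancel-≤
    (ℚᵘ.≤-respˡ-≃ (ℚᵘ.≃-sym (toℚᵘ-/ p m)) (ℚᵘ.≤-respʳ-≃ (ℚᵘ.≃-sym (toℚᵘ-/ q n)) (go m n le)))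
    where
    go : ∀ m n .{{_ : NonZero m}} .{{_ : NonZero n}} → p * n ≤ q * m → (+ p ℚᵘ./ m) ℚᵘ.≤ (+ q ℚᵘ./ n)
    go (suc m) (suc n) le =
      *≤* (subst₂ ℤ._≤_ (ℤ.pos-* p (suc n)) (ℤ.pos-* q (suc m)) (ℤ.+≤+ le))

  /-*-/ : .{{_ : NonZero (m * n)}} → (+ p / m) ℚ.* (+ q / n) ≡ + (p * q) / (m * n)
  /-*-/ = ℚ.toℚᵘ-injective
    (ℚᵘ.≃-trans (ℚ.toℚᵘ-homo-* (+ p / m) (+ q / n))
    (ℚᵘ.≃-trans (ℚᵘ.*-cong (toℚᵘ-/ p m) (toℚᵘ-/ q n))
    (ℚᵘ.≃-trans (go m n) (ℚᵘ.≃-sym (toℚᵘ-/ (p * q) (m * n))))))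
    where
    go : ∀ m n .{{_ : NonZero m}} .{{_ : NonZero n}} .{{_ : NonZero (m * n)}} →
         (+ p ℚᵘ./ m) ℚᵘ.* (+ q ℚᵘ./ n) ℚᵘ.≃ (+ (p * q) ℚᵘ./ (m * n))
    go (suc m) (suc n) = *≡* (cong (ℤ._* + (suc m * suc n)) (sym (ℤ.pos-* p q)))

/-+-/ : ∀ p q m .{{_ : NonZero m}} → (+ p / m) ℚ.+ (+ q / m) ≡ + (p + q) / m
/-+-/ p q m = ℚ.toℚᵘ-injective
  (ℚᵘ.≃-trans (ℚ.toℚᵘ-homo-+ (+ p / m) (+ q / m))
  (ℚᵘ.≃-trans (ℚᵘ.+-cong (toℚᵘ-/ p m) (toℚᵘ-/ q m))
  (ℚᵘ.≃-trans (go m) (ℚᵘ.≃-sym (toℚᵘ-/ (p + q) m)))))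
  where
  identity : ∀ (i j k : ℤ) → (i ℤ.* k ℤ.+ j ℤ.* k) ℤ.* k ≡ (i ℤ.+ j) ℤ.* (k ℤ.* k)
  identity = ℤ-Solver.solve-∀
  go : ∀ m .{{_ : NonZero m}} → (+ p ℚᵘ./ m) ℚᵘ.+ (+ q ℚᵘ./ m) ℚᵘ.≃ (+ (p + q) ℚᵘ./ m)
  go (suc m) = *≡* (identity (+ p) (+ q) (+ suc m))

suc/-∸-/ : ∀ p m .{{_ : NonZero m}} → (+ suc p / m) ℚ.- (+ p / m) ≡ + 1 / m
suc/-∸-/ p m = begin
  (+ suc p / m) ℚ.- (+ p / m)                 ≡⟨ cong (ℚ._- (+ p / m)) (/-+-/ 1 p m) ⟨
  (+ 1 / m) ℚ.+ (+ p / m) ℚ.- (+ p / m)       ≡⟨ ℚ.+-assoc (+ 1 / m) (+ p / m) (ℚ.- (+ p / m)) ⟩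
  (+ 1 / m) ℚ.+ ((+ p / m) ℚ.- (+ p / m))     ≡⟨ cong ((+ 1 / m) ℚ.+_) (ℚ.+-inverseʳ (+ p / m)) ⟩
  (+ 1 / m) ℚ.+ ℚ.0ℚ                          ≡⟨ ℚ.+-identityʳ (+ 1 / m) ⟩
  + 1 / m                                     ∎
  where open ≡-Reasoning

-- Coordinatewise updates

-- Two vectors changed at the same coordinate are compared by one check at `i` and one away from it.
-- `R` sees the index, so it may also mention vectors that stay fixed.
updateAt-elim₂ : ∀ {A B : Set} {n} (R : Fin n → A → B → Set) (i : Fin n) {f : A → A} {g : B → B}
                 {xs : Vector A n} {ys : Vector B n} →
                 R i (f (xs i)) (g (ys i)) → (∀ j → j ≢ i → R j (xs j) (ys j)) →
                 ∀ j → R j (updateAt xs i f j) (updateAt ys i g j)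
updateAt-elim₂ R i {xs = xs} {ys} at off j with j Fin.≟ i
... | yes refl = subst₂ (R j) (sym (updateAt-updates j xs)) (sym (updateAt-updates j ys)) at
... | no  j≢i  = subst₂ (R j) (sym (updateAt-minimal j i xs j≢i)) (sym (updateAt-minimal j i ys j≢i)) (off j j≢i)

updateAt-elim : ∀ {A : Set} {n} (R : Fin n → A → Set) (i : Fin n) {f : A → A} {xs : Vector A n} →
                R i (f (xs i)) → (∀ j → j ≢ i → R j (xs j)) → ∀ j → R j (updateAt xs i f j)
updateAt-elim R i {f} {xs} = updateAt-elim₂ (λ j x _ → R j x) i {f} {f} {xs} {xs}

∑ℕ-updateAt-suc : ∀ {n} (i : Fin n) xs → ∑ℕ (updateAt xs i suc) ≡ suc (∑ℕ xs)
∑ℕ-updateAt-suc zero    xs = refl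
∑ℕ-updateAt-suc (suc i) xs =
  trans (cong (λ k → xs zero + k) (∑ℕ-updateAt-suc i (tail xs))) (+-suc (xs zero) (∑ℕ (tail xs)))

∑ℕ-mono : ∀ {n} {xs ys : Vector ℕ n} → (∀ i → xs i ≤ ys i) → ∑ℕ xs ≤ ∑ℕ ys
∑ℕ-mono {zero}  le = z≤n
∑ℕ-mono {suc n} le = +-mono-≤ (le zero) (∑ℕ-mono (le ∘ suc))

-- Induction on the length: the tail is lowered first, with the head frozen at `xs zero + cs zero`;
-- then the head comes down one unit at a time. `resp` stands in for function extensionality, since
-- the vectors met on the way agree only pointwise.
updateAt-descent : ∀ {n} (Q : Vector ℕ n → Set) → (∀ {xs} ys → xs ≗ ys → Q xs → Q ys) →
                   (∀ i xs → Q (updateAt xs i suc) → Q xs) →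
                   ∀ (xs cs : Vector ℕ n) → Q (λ i → xs i + cs i) → Q xs
updateAt-descent {zero}  Q resp step xs cs q = resp xs (λ ()) q
updateAt-descent {suc n} Q resp step xs cs q =
  resp xs (λ { zero → refl ; (suc _) → refl }) (descend-head (cs zero) descend-tail)
  where
  y = xs zero + cs zero
  descend-tail : Q (y ∷ᵛ tail xs)
  descend-tail = updateAt-descent (λ ys → Q (y ∷ᵛ ys))
    (λ ys eq → resp (y ∷ᵛ ys) λ { zero → refl ; (suc j) → eq j })
    (λ i ys q → step (suc i) (y ∷ᵛ ys)
      (resp (updateAt (y ∷ᵛ ys) (suc i) suc) (λ { zero → refl ; (suc _) → refl }) q))
    (tail xs) (tail cs)
    (resp (y ∷ᵛ λ i → xs (suc i) + cs (suc i)) (λ { zero → refl ; (suc _) → refl }) q)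
  descend-head : ∀ c → Q ((xs zero + c) ∷ᵛ tail xs) → Q (xs zero ∷ᵛ tail xs)
  descend-head zero    q =
    resp (xs zero ∷ᵛ tail xs) (λ { zero → +-identityʳ (xs zero) ; (suc _) → refl }) q
  descend-head (suc c) q = descend-head c (step zero ((xs zero + c) ∷ᵛ tail xs)
    (resp (updateAt ((xs zero + c) ∷ᵛ tail xs) zero suc)
      (λ { zero → +-suc (xs zero) c ; (suc _) → refl }) q))

-- Counting points in boxes

length-filter-⊎ : ∀ {X : Set} {P Q R : X → Set} (P? : Decidable P) (Q? : Decidable Q) (R? : Decidable R) →
                  (∀ {x} → P x → Q x ⊎ R x) → (∀ {x} → Q x → P x) → (∀ {x} → R x → P x) →
                  (∀ {x} → Q x → ¬ R x) → ∀ xs →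
                  length (filter P? xs) ≡ length (filter Q? xs) + length (filter R? xs)
length-filter-⊎ P? Q? R? split Q⊆P R⊆P disj [] = refl
length-filter-⊎ P? Q? R? split Q⊆P R⊆P disj (x ∷ xs)
  with ih ← length-filter-⊎ P? Q? R? split Q⊆P R⊆P disj xs | P? x | Q? x | R? x
... | _      | yes q | yes r = contradiction r (disj q)
... | yes _  | yes _ | no _  = cong suc ih
... | yes _  | no _  | yes _ = trans (cong suc ih) (sym (+-suc _ _))
... | yes p  | no ¬q | no ¬r with split p
...   | inj₁ q = contradiction q ¬q
...   | inj₂ r = contradiction r ¬r
length-filter-⊎ P? Q? R? split Q⊆P R⊆P disj (x ∷ xs)
    | no ¬p  | yes q | no _  = contradiction (Q⊆P q) ¬p
length-filter-⊎ P? Q? R? split Q⊆P R⊆P disj (x ∷ xs)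
    | no ¬p  | no _  | yes r = contradiction (R⊆P r) ¬p
length-filter-⊎ P? Q? R? split Q⊆P R⊆P disj (x ∷ xs)
    | no _   | no _  | no _  = ih

-- The corners are arbitrary rationals because a union of several slabs need not be an elementary
-- interval. At the corners of an `Interval` this unfolds to `Contains`, so `count` and `A` agree
-- definitionally.
InBox : ∀ {s} (lo hi : Vector ℚ s) → Point s → Set
InBox lo hi x = ∀ i → lo i ℚ.≤ x i × x i ℚ.< hi i

inBox? : ∀ {s} (lo hi : Vector ℚ s) (x : Point s) → Dec (InBox lo hi x)
inBox? lo hi x = all? λ i → (lo i ℚ.≤? x i) ×-dec (x i ℚ.<? hi i)

module _ {N s : ℕ} (P : PointSet N s) where

  count : (lo hi : Vector ℚ s) → ℕ
  count lo hi = length (filter (λ n → inBox? lo hi (P n)) (allFin N))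

  count-cong : ∀ {lo lo′ hi hi′} → lo ≗ lo′ → hi ≗ hi′ → count lo hi ≡ count lo′ hi′
  count-cong {lo} {lo′} {hi} {hi′} lo≗ hi≗ = cong length
    (filter-≐ (λ n → inBox? lo hi (P n)) (λ n → inBox? lo′ hi′ (P n))
      ( (λ {n} x∈ i → subst₂ (λ l h → l ℚ.≤ P n i × P n i ℚ.< h) (lo≗ i) (hi≗ i) (x∈ i))
      , (λ {n} x∈ i → subst₂ (λ l h → l ℚ.≤ P n i × P n i ℚ.< h) (sym (lo≗ i)) (sym (hi≗ i)) (x∈ i)))
      (allFin N))

  count-empty : ∀ {lo hi} i → hi i ℚ.≤ lo i → count lo hi ≡ 0
  count-empty {lo} {hi} i hi≤lo = cong length
    (filter-none (λ n → inBox? lo hi (P n)) {allFin N}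
      (universal (λ n x∈ → ℚ.<-irrefl refl
        (ℚ.<-≤-trans (proj₂ (x∈ i)) (ℚ.≤-trans hi≤lo (proj₁ (x∈ i))))) (allFin N)))

  -- Boxes are half-open, so a point with `i`-th coordinate exactly `q` falls in the upper part
  -- only. The bounds on `q` keep both parts inside the box.
  count-split : ∀ lo hi i q → lo i ℚ.≤ q → q ℚ.≤ hi i →
                count lo hi ≡ count lo (updateAt hi i (const q)) + count (updateAt lo i (const q)) hi
  count-split lo hi i q lo≤q q≤hi =
    length-filter-⊎ (λ n → inBox? lo hi (P n)) (λ n → inBox? lo hi′ (P n)) (λ n → inBox? lo′ hi (P n))
      split below⊆ above⊆ disj (allFin N)
    where
    lo′ = updateAt lo i (const q)
    hi′ = updateAt hi i (const q)

    split : ∀ {n} → InBox lo hi (P n) → InBox lo hi′ (P n) ⊎ InBox lo′ hi (P n)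
    split {n} x∈ with P n i ℚ.<? q
    ... | yes x<q = inj₁ (updateAt-elim (λ j h → lo j ℚ.≤ P n j × P n j ℚ.< h) i
                      (proj₁ (x∈ i) , x<q) (λ j _ → x∈ j))
    ... | no  x≮q = inj₂ (updateAt-elim (λ j l → l ℚ.≤ P n j × P n j ℚ.< hi j) i
                      (ℚ.≮⇒≥ x≮q , proj₂ (x∈ i)) (λ j _ → x∈ j))

    hi′≤hi : ∀ j → hi′ j ℚ.≤ hi j
    hi′≤hi = updateAt-elim (λ j h → h ℚ.≤ hi j) i q≤hi (λ _ _ → ℚ.≤-refl)

    lo≤lo′ : ∀ j → lo j ℚ.≤ lo′ j
    lo≤lo′ = updateAt-elim (λ j l → lo j ℚ.≤ l) i lo≤q (λ _ _ → ℚ.≤-refl)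

    below⊆ : ∀ {n} → InBox lo hi′ (P n) → InBox lo hi (P n)
    below⊆ x∈ j = proj₁ (x∈ j) , ℚ.<-≤-trans (proj₂ (x∈ j)) (hi′≤hi j)

    above⊆ : ∀ {n} → InBox lo′ hi (P n) → InBox lo hi (P n)
    above⊆ x∈ j = ℚ.≤-trans (lo≤lo′ j) (proj₁ (x∈ j)) , proj₂ (x∈ j)

    disj : ∀ {n} → InBox lo hi′ (P n) → ¬ InBox lo′ hi (P n)
    disj {n} below above = ℚ.<-irrefl refl (ℚ.<-≤-trans
      (subst (P n i ℚ.<_) (updateAt-updates i hi) (proj₂ (below i)))
      (subst (ℚ._≤ P n i) (updateAt-updates i lo) (proj₁ (above i))))

  -- Induction on `n`, splitting off the topmost slab at `g n`; for `n = 0` the box is empty, as it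
  -- ends where it starts. The weight `w` lets the slab equations be added without dividing.
  count-slabs : ∀ {lo hi : Vector ℚ s} i (g : ℕ → ℚ) → (∀ {c d} → c ≤ d → g c ℚ.≤ g d) → lo i ≡ g 0 →
                ∀ {w v} n →
                (∀ c → c < n → count (updateAt lo i (const (g c))) (updateAt hi i (const (g (suc c)))) * w ≡ v) →
                count lo (updateAt hi i (const (g n))) * w ≡ n * v
  count-slabs {lo} {hi} i g mono lo≡ {w} {v} zero slab =
    cong (_* w) (count-empty i (ℚ.≤-reflexive (trans (updateAt-updates i hi) (sym lo≡))))
  count-slabs {lo} {hi} i g mono lo≡ {w} {v} (suc n) slab = begin
    count lo hi₊ * w
      ≡⟨ cong (_* w) (count-split lo hi₊ i (g n)
           (ℚ.≤-trans (ℚ.≤-reflexive lo≡) (mono z≤n))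
           (ℚ.≤-trans (mono (n≤1+n n)) (ℚ.≤-reflexive (sym (updateAt-updates i hi))))) ⟩
    (count lo (updateAt hi₊ i (const (g n))) + count (updateAt lo i (const (g n))) hi₊) * w
      ≡⟨ *-distribʳ-+ w (count lo (updateAt hi₊ i (const (g n)))) _ ⟩
    count lo (updateAt hi₊ i (const (g n))) * w + count (updateAt lo i (const (g n))) hi₊ * w
      ≡⟨ cong₂ _+_ (cong (_* w) (count-cong (λ _ → refl) (updateAt-updateAt i hi))) (slab n ≤-refl) ⟩
    count lo (updateAt hi i (const (g n))) * w + v
      ≡⟨ cong (_+ v) (count-slabs i g mono lo≡ n (λ c c<n → slab c (m<n⇒m<1+n c<n))) ⟩
    n * v + v
      ≡⟨ +-comm (n * v) v ⟩
    suc n * v ∎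
    where
    open ≡-Reasoning
    hi₊ = updateAt hi i (const (g (suc n)))

-- Elementary intervals and equidistribution in base `b`

module _ (b : ℕ) .{{_ : NonTrivial b}} where

  private
    instance
      b≢0 : NonZero b
      b≢0 = nonTrivial⇒nonZero b

    infixl 7 _/ᵇ_
    _/ᵇ_ : ℕ → ℕ → ℚ
    _/ᵇ_ = _/b^_ b

    b^ : ∀ d → NonZero (b ^ d)
    b^ d = m^n≢0 b d

  /ᵇ-cong : ∀ p q c d → p * b ^ d ≡ q * b ^ c → p /ᵇ c ≡ q /ᵇ d
  /ᵇ-cong p q c d = *≡*⇒/≡/ p q (b ^ c) (b ^ d) {{b^ c}} {{b^ d}}

  /ᵇ-injective : ∀ p q c d → p /ᵇ c ≡ q /ᵇ d → p * b ^ d ≡ q * b ^ c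
  /ᵇ-injective p q c d = /≡/⇒*≡* p q (b ^ c) (b ^ d) {{b^ c}} {{b^ d}}

  /ᵇ-mono : ∀ p q c d → p * b ^ d ≤ q * b ^ c → p /ᵇ c ℚ.≤ q /ᵇ d
  /ᵇ-mono p q c d = *≤*⇒/≤/ p q (b ^ c) (b ^ d) {{b^ c}} {{b^ d}}

  /ᵇ-*-/ᵇ : ∀ p q c d → (p /ᵇ c) ℚ.* (q /ᵇ d) ≡ (p * q) /ᵇ (c + d)
  /ᵇ-*-/ᵇ p q c d = trans
    (/-*-/ p q (b ^ c) (b ^ d) {{b^ c}} {{b^ d}} {{b^c*b^d≢0}})
    (*≡*⇒/≡/ (p * q) (p * q) (b ^ c * b ^ d) (b ^ (c + d)) {{b^c*b^d≢0}} {{b^ (c + d)}}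
      (cong (p * q *_) (^-distribˡ-+-* b c d)))
    where
    b^c*b^d≢0 = m*n≢0 (b ^ c) (b ^ d) {{b^ c}} {{b^ d}}

  -- Multiplied by b ^ Σd, so that neither subtraction nor division occurs; v
  -- stands for b ^ m.
  Equidistributed : ∀ {N s} → PointSet N s → ℕ → Vector ℕ s → Set
  Equidistributed {s = s} P v d = ∀ (a : Vector ℕ s) → (∀ i → a i < b ^ d i) →
    count P (λ i → a i /ᵇ d i) (λ i → suc (a i) /ᵇ d i) * b ^ ∑ℕ d ≡ v

  Equidistributed-resp : ∀ {N s} (P : PointSet N s) {v} {d} (d′ : Vector ℕ s) → d ≗ d′ →
                         Equidistributed P v d → Equidistributed P v d′
  Equidistributed-resp P {v} {d} d′ eq equi a a< = trans
    (cong₂ _*_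
      (count-cong P (λ i → cong (a i /ᵇ_) (sym (eq i))) (λ i → cong (suc (a i) /ᵇ_) (sym (eq i))))
      (cong (b ^_) (sym (sum-cong-≗ eq))))
    (equi a (λ i → subst (λ k → a i < b ^ k) (sym (eq i)) (a< i)))

  -- Each of the `b` slabs contributes `v` under the weight `b ^ suc (∑ℕ d)` of the refined shape,
  -- so the whole interval contributes `b * v`. Cancelling `b` restores the weight `b ^ ∑ℕ d`.
  Equidistributed-step : ∀ {N s} (P : PointSet N s) {v} i (d : Vector ℕ s) →
                         Equidistributed P v (updateAt d i suc) → Equidistributed P v d
  Equidistributed-step {s = s} P {v} i d equi a a< = *-cancelˡ-≡ _ v b (begin
    b * (count P lo hi * b ^ ∑ℕ d)
      ≡⟨ rearrange b (count P lo hi) (b ^ ∑ℕ d) ⟩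
    count P lo hi * b ^ suc (∑ℕ d)
      ≡⟨ cong (_* b ^ suc (∑ℕ d)) (count-cong P (λ _ → refl) (sym ∘ updateAt-id-local i hi last-cut)) ⟩
    count P lo (updateAt hi i (const (g b))) * b ^ suc (∑ℕ d)
      ≡⟨ count-slabs P i g mono first-cut b slab ⟩
    b * v ∎)
    where
    open ≡-Reasoning
    lo hi : Vector ℚ s
    lo j = a j /ᵇ d j
    hi j = suc (a j) /ᵇ d j

    -- The cuts along coordinate `i`: from `g c` to `g (suc c)` runs the edge with index
    -- `a i * b + c` at resolution `suc (d i)`. The cuts `g 0` and `g b` are the ends of the
    -- original edge.
    g : ℕ → ℚ
    g c = (a i * b + c) /ᵇ suc (d i)

    mono : ∀ {c c′} → c ≤ c′ → g c ℚ.≤ g c′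
    mono {c} {c′} c≤c′ = /ᵇ-mono (a i * b + c) (a i * b + c′) (suc (d i)) (suc (d i))
      (*-monoˡ-≤ (b ^ suc (d i)) (+-monoʳ-≤ (a i * b) c≤c′))

    rearrange : ∀ x y z → x * (y * z) ≡ y * (x * z)
    rearrange = solve-∀

    first-cut : lo i ≡ g 0
    first-cut = /ᵇ-cong (a i) (a i * b + 0) (d i) (suc (d i)) (identity (a i) b (b ^ d i))
      where
      identity : ∀ x y z → x * (y * z) ≡ (x * y + 0) * z
      identity = solve-∀

    last-cut : g b ≡ hi i
    last-cut = /ᵇ-cong (a i * b + b) (suc (a i)) (suc (d i)) (d i) (identity (a i) b (b ^ d i))
      where
      identity : ∀ x y z → (x * y + y) * z ≡ (1 + x) * (y * z)
      identity = solve-∀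

    slab : ∀ c → c < b →
           count P (updateAt lo i (const (g c))) (updateAt hi i (const (g (suc c)))) * b ^ suc (∑ℕ d) ≡ v
    slab c c<b = trans
      (cong₂ _*_ (count-cong P lo-slab hi-slab) (cong (b ^_) (sym (∑ℕ-updateAt-suc i d))))
      (equi a′ (updateAt-elim₂ (λ _ x y → x < b ^ y) i bound (λ j _ → a< j)))
      where
      a′ = updateAt a i (λ x → x * b + c)
      d′ = updateAt d i suc

      -- From `c < b` the index lies below `(a i + 1) * b`, and `a i + 1` is at most `b ^ d i`.
      bound : a i * b + c < b ^ suc (d i)
      bound = <-≤-trans (+-monoʳ-< (a i * b) c<b)
        (≤-trans (≤-reflexive (+-comm (a i * b) b))
        (≤-trans (*-monoˡ-≤ b (a< i)) (≤-reflexive (*-comm (b ^ d i) b))))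

      lo-slab : updateAt lo i (const (g c)) ≗ λ j → a′ j /ᵇ d′ j
      lo-slab j = sym (updateAt-elim₂ (λ j x y → x /ᵇ y ≡ updateAt lo i (const (g c)) j) i
        (sym (updateAt-updates i lo)) (λ j j≢i → sym (updateAt-minimal j i lo j≢i)) j)

      hi-slab : updateAt hi i (const (g (suc c))) ≗ λ j → suc (a′ j) /ᵇ d′ j
      hi-slab j = sym (updateAt-elim₂ (λ j x y → suc x /ᵇ y ≡ updateAt hi i (const (g (suc c))) j) i
        (trans (cong (_/ᵇ suc (d i)) (sym (+-suc (a i * b) c))) (sym (updateAt-updates i hi)))
        (λ j j≢i → sym (updateAt-minimal j i hi j≢i)) j)

  -- Volumes and the passage between the two kinds of net

  ∏-1/ : ∀ {s} (d : Vector ℕ s) (f : Vector ℚ s) → (∀ i → f i ≡ 1 /ᵇ d i) → ∏ f ≡ 1 /ᵇ ∑ℕ d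
  ∏-1/ {zero}  d f f≡ = refl
  ∏-1/ {suc s} d f f≡ = begin
    f zero ℚ.* ∏ (tail f)                   ≡⟨ cong₂ ℚ._*_ (f≡ zero) (∏-1/ (tail d) (tail f) (f≡ ∘ suc)) ⟩
    (1 /ᵇ d zero) ℚ.* (1 /ᵇ ∑ℕ (tail d))    ≡⟨ /ᵇ-*-/ᵇ 1 1 (d zero) (∑ℕ (tail d)) ⟩
    1 /ᵇ (d zero + ∑ℕ (tail d))             ∎
    where open ≡-Reasoning

  Vol≡ : ∀ {s} (J : Interval b s) → Interval.Vol J ≡ 1 /ᵇ ∑ℕ (Interval.d J)
  Vol≡ J = ∏-1/ d _ (λ i → suc/-∸-/ (toℕ (a i)) (b ^ d i) {{b^ (d i)}})
    where open Interval J

  -- Only denominators are cleared: the inequality is `Vol J ≥ b^u / b^m` multiplied by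
  -- `b ^ m * b ^ ∑ℕ d`, and the conclusion is the net equation multiplied by `b ^ ∑ℕ d`.
  UMES⇒Equidistributed : ∀ {u m s} {e : Vector ℕ s} {P} → IsUMESNet b u m e P →
    ∀ d → (∀ i → e i ∣ d i) → b ^ u * b ^ ∑ℕ d ≤ b ^ m → Equidistributed P (b ^ m) d
  UMES⇒Equidistributed {u} {m} {s} {e} {P} (_ , _ , net) d e∣d le a a< = begin
    count P (λ i → a i /ᵇ d i) (λ i → suc (a i) /ᵇ d i) * b ^ ∑ℕ d
      ≡⟨ cong (_* b ^ ∑ℕ d) (count-cong P (λ i → cong (_/ᵇ d i) (sym (toℕ-fromℕ< (a< i))))
           (λ i → cong (λ k → suc k /ᵇ d i) (sym (toℕ-fromℕ< (a< i))))) ⟩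
    A b J P * b ^ ∑ℕ d
      ≡⟨ /ᵇ-injective (A b J P) (b ^ m * 1) 0 (∑ℕ d) count≡ ⟩
    b ^ m * 1 * 1
      ≡⟨ trans (*-identityʳ (b ^ m * 1)) (*-identityʳ (b ^ m)) ⟩
    b ^ m ∎
    where
    open ≡-Reasoning
    J : Interval b s
    J = record { d = d ; a = λ i → fromℕ< (a< i) }

    volume : Interval.Vol J ℚ.≥ b ^ u /ᵇ m
    volume = subst ((b ^ u /ᵇ m) ℚ.≤_) (sym (Vol≡ J))
      (/ᵇ-mono (b ^ u) 1 m (∑ℕ d) (≤-trans le (≤-reflexive (sym (*-identityˡ (b ^ m))))))

    -- `b ^ 0` computes to 1, so the integers in the net equation are already fractions of the form
    -- `_ /ᵇ 0`.
    count≡ : A b J P /ᵇ 0 ≡ (b ^ m * 1) /ᵇ ∑ℕ d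
    count≡ = trans (net J e∣d volume) (trans (cong ((b ^ m /ᵇ 0) ℚ.*_) (Vol≡ J)) (/ᵇ-*-/ᵇ (b ^ m) 1 0 (∑ℕ d)))

  UMES⇒TMS : ∀ {u m s} {e : Vector ℕ s} {P} → (∀ i → e i ≥ 1) → u + ∑ℕ (λ i → e i ∸ 1) ≤ m →
             IsUMESNet b u m e P → IsTMSNet b (u + ∑ℕ (λ i → e i ∸ 1)) m P
  UMES⇒TMS {u} {m} {s} {e} {P} e≥1 t≤m umes@(_ , inCube , _) = t≤m , inCube , count≡
    where
    t = u + ∑ℕ (λ i → e i ∸ 1)
    count≡ : ∀ (J : Interval b s) → Interval.Vol J ≡ _/b^_ b (b ^ t) m → A b J P ≡ b ^ t
    count≡ J vol = *-cancelʳ-≡ (A b J P) (b ^ t) (b ^ ∑ℕ d) {{b^ (∑ℕ d)}} (trans equi (sym volume))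
      where
      open Interval J
      pad : Vector ℕ s
      pad i = proj₁ (∣-round-up (e i) (d i) (e≥1 i))

      -- The hypothesis on `Vol J`, cross-multiplied: it says that `t + ∑ℕ d` equals `m`, in
      -- exponential form.
      volume : b ^ t * b ^ ∑ℕ d ≡ b ^ m
      volume = trans (sym (/ᵇ-injective 1 (b ^ t) (∑ℕ d) m (trans (sym (Vol≡ J)) vol))) (*-identityˡ (b ^ m))

      -- The padding totals at most `t` minus `u`, so it fits in the gap between the two volume
      -- thresholds.
      padded : b ^ u * b ^ ∑ℕ (λ i → d i + pad i) ≤ b ^ m
      padded = begin
        b ^ u * b ^ ∑ℕ (λ i → d i + pad i)   ≡⟨ ^-distribˡ-+-* b u _ ⟨
        b ^ (u + ∑ℕ (λ i → d i + pad i))     ≤⟨ ^-monoʳ-≤ b exponents ⟩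
        b ^ (t + ∑ℕ d)                       ≡⟨ ^-distribˡ-+-* b t (∑ℕ d) ⟩
        b ^ t * b ^ ∑ℕ d                     ≡⟨ volume ⟩
        b ^ m                                ∎
        where
        open ≤-Reasoning
        exponents : u + ∑ℕ (λ i → d i + pad i) ≤ t + ∑ℕ d
        exponents = begin
          u + ∑ℕ (λ i → d i + pad i)         ≡⟨ cong (λ k → u + k) (trans (∑-distrib-+ d pad) (+-comm (∑ℕ d) (∑ℕ pad))) ⟩
          u + (∑ℕ pad + ∑ℕ d)                ≡⟨ +-assoc u (∑ℕ pad) (∑ℕ d) ⟨
          u + ∑ℕ pad + ∑ℕ d                  ≤⟨ +-monoˡ-≤ (∑ℕ d) (+-monoʳ-≤ u (∑ℕ-mono
                                                  (λ i → proj₁ (proj₂ (∣-round-up (e i) (d i) (e≥1 i)))))) ⟩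
          t + ∑ℕ d                           ∎

      -- The hypothesis covers the shape `d + pad`; descending by `pad` returns to `d`, and the
      -- indices of `J` are then put in.
      equi : A b J P * b ^ ∑ℕ d ≡ b ^ m
      equi = updateAt-descent (Equidistributed P (b ^ m)) (Equidistributed-resp P) (Equidistributed-step P) d pad
        (UMES⇒Equidistributed {u} {m} {s} {e} {P} umes (λ i → d i + pad i)
          (λ i → proj₂ (proj₂ (∣-round-up (e i) (d i) (e≥1 i)))) padded)
        (toℕ ∘ a) (λ i → toℕ<n (a i))

corollary1 : (b : ℕ) .{{_ : NonTrivial b}} (s u : ℕ) → s ≥ 1 →
    (e : Fin s → ℕ) → (∀ i → e i ≥ 1) →
    (x : PointSequence b s) → IsUESSequence b u e x →
    IsTSSequence b (u + ∑ℕ (λ i → e i ∸ 1)) x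
-- Since `u` is at most `t`, any `m > t` also exceeds `u`, so the same block is a net by hypothesis.
corollary1 b s u _ e e≥1 x ues k m m>t =
  UMES⇒TMS b {u} {m} {s} {e} {block b x k m} e≥1 (<⇒≤ m>t) (ues k m (≤-<-trans (m≤m+n u _) m>t))
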